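{- Let $G=(V,E)$ be a $(2t+1)$ edge-connected graph of diameter $D$ with a source node $s$ holding a message $m_0$, and let $L$ be a parameter such that for every $u,v\in V$ and every $E'\subseteq E$ with $|E'|\le 2t$, $\mathrm{dist}_{G\setminus E'}(u,v)\le L$. Assuming the nodes locally know an $(L,2t)$ covering family $\mathcal{G}$ of $G$ (and know $L$ and $t$), there exists a deterministic broadcast algorithm in the adversarial \textsc{CONGEST} model against $t$ adversarial edges with round complexity $O(L\cdot|\mathcal{G}|)$.
   Context: An $(L,k)$ covering family of $G$ is a family of subgraphs $\mathcal{G}=\{G_1,\dots,G_\ell\}$, $G_i\subseteq G$, such that for every $u,v\in V$, every set $E'\subseteq E$ with $|E'|\le k$, and every $u$-$v$ path $P\subseteq G\setminus E'$ of length at most $L$, there is some $G_i$ with $P\subseteq G_i$ and $E'\cap G_i=\emptyset$. An ordered family $\mathcal{G}$ is locally known if, given the identifier of an edge $e=(u,v)$ and an index $i$, the nodes $u,v$ can locally determine whether $e\in G_i$. Adversarial CONGEST model: $n$-node network $G$, unique $O(\log n)$-bit IDs, each node initially knows its incident edges' identifiers and a polynomial estimate of $n$; synchronous rounds with $O(\log n)$-bit messages per edge per round; a computationally unbounded adaptive adversary, knowing topology, protocol and random coins, controls a fixed set $F$ of at most $t$ edges unknown to the nodes (nodes know $t$), and may send arbitrary messages over them (possibly different per direction) based on all communication so far. Broadcast: all nodes must output $m_0$, ignoring all other messages. -}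

module Defs where

open import Data.Nat using (ℕ; zero; suc; _+_; _*_; _^_; _≤_; _<_; _<ᵇ_; _≡ᵇ_)
open import Data.Bool using (Bool; true; false; T; _∧_; not; if_then_else_)
open import Data.Fin using (Fin; toℕ) renaming (_≟_ to _≟ᶠ_)
open import Data.List using (List; []; _∷_; map; allFin; foldr)
open import Data.Nat.ListAction using (sum)
open import Data.List.Relation.Unary.Unique.Propositional using (Unique)
open import Data.Maybe using (Maybe; just; nothing)
open import Data.Product using (Σ; _×_; ∃; ∃-syntax; proj₁)
open import Data.Empty using (⊥)
open import Data.Unit using (⊤)
open import Relation.Binary.PropositionalEquality using (_≡_)
open import Relation.Nullary using (yes; no)
open import Data.Nat.Properties using (_<?_)

EdgeSet : ℕ → Set
EdgeSet n = Fin n → Fin n → Bool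

record Graph (n : ℕ) : Set where
  field
    adj   : EdgeSet n
    sym   : ∀ u v → adj u v ≡ adj v u
    irrefl : ∀ u → adj u u ≡ false
open Graph public

IsEdgeSubset : ∀ {n} → Graph n → EdgeSet n → Set
IsEdgeSubset G S = (∀ u v → S u v ≡ S v u) × (∀ u v → T (S u v) → T (adj G u v))

edgeCount : ∀ {n} → EdgeSet n → ℕ
edgeCount {n} S =
  sum (map (λ u → sum (map (λ v → if (toℕ u <ᵇ toℕ v) ∧ S u v then 1 else 0)
                               (allFin n)))
           (allFin n))

remove : ∀ {n} → EdgeSet n → EdgeSet n → EdgeSet n
remove H E′ u v = H u v ∧ not (E′ u v)

Disjoint : ∀ {n} → EdgeSet n → EdgeSet n → Set
Disjoint A B = ∀ u v → T (A u v) → T (B u v) → ⊥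

data Walk {n} (H : EdgeSet n) : Fin n → Fin n → ℕ → Set where
  here : ∀ u → Walk H u u 0
  step : ∀ {u w v k} → T (H u w) → Walk H w v k → Walk H u v (suc k)

vertices : ∀ {n} {H : EdgeSet n} {u v k} → Walk H u v k → List (Fin n)
vertices (here u) = u ∷ []
vertices (step {u = u} _ p) = u ∷ vertices p

WalkIn : ∀ {n} {H : EdgeSet n} {u v k} → Walk H u v k → EdgeSet n → Set
WalkIn (here _) A = ⊤
WalkIn (step {u = u} {w = w} _ p) A = T (A u w) × WalkIn p A

Path : ∀ {n} → EdgeSet n → Fin n → Fin n → ℕ → Set
Path H u v k = Σ (Walk H u v k) λ p → Unique (vertices p)

IsCoveringFamily : ∀ {n} → Graph n → ℕ → ℕ → (ℓ : ℕ) → (Fin ℓ → EdgeSet n) → Set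
IsCoveringFamily {n} G L k ℓ fam =
  (∀ i → IsEdgeSubset G (fam i)) ×
  (∀ (u v : Fin n) (E′ : EdgeSet n) → IsEdgeSubset G E′ → edgeCount E′ ≤ k →
     ∀ m → m ≤ L → (P : Path (remove (adj G) E′) u v m) →
     ∃[ i ] (WalkIn (proj₁ P) (fam i) × Disjoint E′ (fam i)))

IsEdgeConnected : ∀ {n} → Graph n → ℕ → Set
IsEdgeConnected {n} G c =
  ∀ (E′ : EdgeSet n) → IsEdgeSubset G E′ → suc (edgeCount E′) ≤ c →
  ∀ (u v : Fin n) → ∃[ m ] Path (remove (adj G) E′) u v m

FaultDistBound : ∀ {n} → Graph n → ℕ → ℕ → Set
FaultDistBound {n} G k L =
  ∀ (E′ : EdgeSet n) → IsEdgeSubset G E′ → edgeCount E′ ≤ k →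
  ∀ (u v : Fin n) → ∃[ m ] (m ≤ L × Path (remove (adj G) E′) u v m)

record LocalInput : Set where
  field
    myId    : ℕ
    nEst    : ℕ              -- polynomial estimate N of n
    tIn     : ℕ
    LIn     : ℕ
    ℓIn     : ℕ
    nbrs    : List ℕ
    inCover : ℕ → Fin ℓIn → Bool
      -- inCover w i : is the incident edge {me , w} in G_i (false if w is no neighbour)
    srcMsg  : Maybe ℕ

-- A deterministic distributed algorithm (the same code at all nodes).
-- In every round a node sends one message to each neighbour (addressed by
-- the neighbour's identifier), then receives the messages of all neighbours
-- (indexed by the sender's identifier; 0 for non-neighbours) and updates its state.
record Algorithm : Set₁ where
  field
    State : Set
    init  : LocalInput → State
    send  : State → ℕ → ℕ
    recv  : State → (ℕ → ℕ) → State
    out   : State → Maybe ℕ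
open Algorithm public

-- messages carry at most B·log N bits: values are cut to the range [0, N^B)
clip : ℕ → ℕ → ℕ
clip bound m with m <? bound
... | yes _ = m
... | no  _ = 0

firstWith : ∀ {n} → List (Fin n) → (Fin n → Bool) → (Fin n → ℕ) → ℕ
firstWith [] p f = 0
firstWith (v ∷ vs) p f = if p v then f v else firstWith vs p f

neighbourIds : ∀ {n} → Graph n → (Fin n → ℕ) → Fin n → List ℕ
neighbourIds {n} G ID u =
  foldr (λ v acc → if adj G u v then ID v ∷ acc else acc) [] (allFin n)

record Instance (n : ℕ) : Set where
  field
    graph : Graph n
    ID    : Fin n → ℕ
    N     : ℕ                      -- estimate of n known to all nodes
    t     : ℕ
    L     : ℕ
    ℓ     : ℕ
    fam   : Fin ℓ → EdgeSet n
    src   : Fin n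
    m₀    : ℕ
open Instance public

localInput : ∀ {n} → Instance n → Fin n → LocalInput
localInput {n} I u = record
  { myId = ID I u ; nEst = N I ; tIn = t I ; LIn = L I ; ℓIn = ℓ I
  ; nbrs = neighbourIds (graph I) (ID I) u
  ; inCover = λ w i → firstWith (allFin n)
                         (λ v → (ID I v ≡ᵇ w) ∧ adj (graph I) u v)
                         (λ v → if fam I i u v then 1 else 0) ≡ᵇ 1
  ; srcMsg = srcOf u }
  where
  srcOf : Fin n → Maybe ℕ
  srcOf u with u ≟ᶠ src I
  ... | yes _ = just (m₀ I)
  ... | no  _ = nothing

-- Execution for bandwidth exponent B, adversarial edge set F and an
-- adversary schedule adv r v u = message put on the directed edge v→u in round r
-- (used only if {v,u} ∈ F).  Since the algorithm is deterministic, quantifying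
-- over all schedules covers every adaptive, computationally unbounded adversary.
execute : ∀ {n} (A : Algorithm) (I : Instance n) (B : ℕ) (F : EdgeSet n)
          (adv : ℕ → Fin n → Fin n → ℕ) → ℕ → Fin n → State A
execute {n} A I B F adv zero u = init A (localInput I u)
execute {n} A I B F adv (suc r) u =
  recv A (execute A I B F adv r u) incoming
  where
  msg : Fin n → ℕ
  msg v = clip (N I ^ B)
            (if F v u then adv r v u else send A (execute A I B F adv r v) (ID I u))
  incoming : ℕ → ℕ
  incoming w = firstWith (allFin n) (λ v → (ID I v ≡ᵇ w) ∧ adj (graph I) u v) msg

{-# OPTIONS --safe #-}
-- For each Gᵢ in turn the message is flooded through Gᵢ for L rounds, every node keeping the first
-- message it hears and the neighbour it came from as its parent; then for L rounds every node tells
-- its neighbours its parent and, round by round, the ancestors its own parent reports, so that it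
-- learns the path its message took. A node accepts m if no t edges hit all the paths along which m
-- reached it. A path that delivered a wrong message contains an adversarial edge, so F hits all of
-- these. For the right message and any t edges S, some Gᵢ disjoint from F ∪ S contains a path of
-- length at most L to the source; flooding through this Gᵢ is undisturbed, so the recorded path
-- lies in Gᵢ and avoids S.

module Submission where

open import Defs renaming (sym to adj-sym)
open import Data.Nat using (ℕ; zero; suc; _+_; _*_; _^_; _≤_; _<_; _⊓_; _⊔_; _≡ᵇ_; _<ᵇ_; z≤n; s≤s; _≟_; _<?_)
open import Data.Nat.Properties
open import Data.Fin using (Fin; zero; suc; toℕ; fromℕ<; combine; remQuot; splitAt; _↑ˡ_; _↑ʳ_) renaming (_≟_ to _≟ᶠ_)
open import Data.Fin.Properties using (toℕ-injective; toℕ<n; toℕ-fromℕ<; toℕ-combine; toℕ-↑ˡ; toℕ-↑ʳ; remQuot-combine; splitAt-↑ˡ; splitAt-↑ʳ)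
open import Data.Bool using (Bool; true; false; T; T?; _∧_; if_then_else_)
open import Data.Bool.Properties using (T-∧)
open import Data.Nat.ListAction using (sum)
open import Data.List using (List; []; _∷_; _++_; map; filter; length; head; mapMaybe; upTo; allFin; foldr; cartesianProduct)
open import Data.List.Properties using (length-map; length-++; filter-++; filter-notAll)
open import Data.List.Membership.Propositional using (_∈_; find; lose)
open import Data.List.Membership.Propositional.Properties
open import Data.List.Relation.Unary.Any using (Any; here; there; any?)
import Data.List.Relation.Unary.Any.Properties as Anyₚ
open import Data.List.Relation.Unary.All using (All; []; _∷_)
import Data.List.Relation.Unary.All as All
open import Data.List.Relation.Unary.Unique.Propositional using (Unique; []; _∷_)
import Data.List.Relation.Unary.Unique.Propositional.Properties as Uniqueₚ
open import Data.Maybe using (Maybe; just; nothing; _<∣>_; maybe′)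
import Data.Maybe as Maybe
import Data.Maybe.Relation.Unary.Any as MaybeAny
open import Data.Maybe.Properties using (just-injective)
import Data.Maybe.Properties as Maybeₚ
open import Data.Product using (Σ; _×_; _,_; ∃-syntax; proj₁; proj₂)
import Data.Product.Properties as Productₚ
open import Data.Sum using (_⊎_; inj₁; inj₂; [_,_]′)
open import Data.Empty using (⊥-elim)
open import Function using (_∘_; case_of_; Equivalence)
open import Function.Definitions using (Injective)
open import Relation.Binary.Definitions using (tri<; tri≈; tri>)
open import Relation.Binary.PropositionalEquality using (_≡_; _≢_; refl; sym; trans; cong; cong₂; subst; module ≡-Reasoning)
open import Relation.Nullary using (¬_; Dec; does; yes; no; ¬?; contradiction)
open import Relation.Nullary.Decidable using (map′; ⌊_⌋; toWitness; fromWitness)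
open import Relation.Unary using (Decidable)

-- Hitting sets

Edge : Set
Edge = ℕ × ℕ

_≟ᵉ_ : (e e′ : Edge) → Dec (e ≡ e′)
_≟ᵉ_ = Productₚ.≡-dec _≟_ _≟_

_∈?_ : (e : Edge) (es : List Edge) → Dec (e ∈ es)
e ∈? es = any? (e ≟ᵉ_) es

delete : Edge → List Edge → List Edge
delete e = filter (λ e′ → ¬? (e′ ≟ᵉ e))

∈-delete : ∀ {e e′ S} → e′ ∈ S → e′ ≢ e → e′ ∈ delete e S
∈-delete {e} = ∈-filter⁺ (λ e′ → ¬? (e′ ≟ᵉ e))

delete-shorter : ∀ {e S} → e ∈ S → length (delete e S) < length S
delete-shorter {e} {S} e∈S =
  filter-notAll (λ e′ → ¬? (e′ ≟ᵉ e)) S (lose e∈S (λ e≢e → e≢e refl))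

unique-⊆⇒length≤ : ∀ {es S} → Unique es → (∀ {e} → e ∈ es → e ∈ S) → length es ≤ length S
unique-⊆⇒length≤ {[]}     _               _    = z≤n
unique-⊆⇒length≤ {e ∷ es} (e∉es ∷ unique) es⊆S =
  ≤-trans (s≤s (unique-⊆⇒length≤ unique
                 (λ e′∈ → ∈-delete (es⊆S (there e′∈)) (λ { refl → All.lookup e∉es e′∈ refl }))))
          (delete-shorter (es⊆S (here refl)))

Hits : List Edge → List Edge → Set
Hits S = Any (_∈ S)

Hittable : ℕ → List (List Edge) → Set
Hittable t Ps = ∃[ S ] (length S ≤ t × All (Hits S) Ps)

hits-weaken : ∀ {S S′} → (∀ {e} → e ∈ S → e ∈ S′) → ∀ {P} → Hits S P → Hits S′ P
hits-weaken S⊆S′ h = let _ , e∈P , e∈S = find h in lose e∈P (S⊆S′ e∈S)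

avoiding : Edge → List (List Edge) → List (List Edge)
avoiding e = filter (λ Q → ¬? (e ∈? Q))

branch : ∀ {t P Ps} → Any (λ e → Hittable t (avoiding e Ps)) P → Hittable (suc t) (P ∷ Ps)
branch {Ps = Ps} h with find h
... | e , e∈P , S , |S|≤t , S-hits =
  e ∷ S , s≤s |S|≤t , lose e∈P (here refl) ∷ All.tabulate hitsQ
  where
  hitsQ : ∀ {Q} → Q ∈ Ps → Hits (e ∷ S) Q
  hitsQ {Q} Q∈Ps with e ∈? Q
  ... | yes e∈Q = lose e∈Q (here refl)
  ... | no  e∉Q = hits-weaken there (All.lookup S-hits (∈-filter⁺ (λ Q → ¬? (e ∈? Q)) Q∈Ps e∉Q))

-- The branching edge is one at which `S` hits `P`. A path avoiding it is hit by some other member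
-- of `S`, so `delete e S` still works, and the budget has dropped by one.
unbranch : ∀ {t P Ps} → Hittable (suc t) (P ∷ Ps) → Any (λ e → Hittable t (avoiding e Ps)) P
unbranch {t} {Ps = Ps} (S , |S|≤1+t , h ∷ hs) with find h
... | e , e∈P , e∈S =
  lose e∈P (delete e S , ≤-pred (≤-trans (delete-shorter e∈S) |S|≤1+t) , All.tabulate hitsQ)
  where
  hitsQ : ∀ {Q} → Q ∈ avoiding e Ps → Hits (delete e S) Q
  hitsQ Q∈ with ∈-filter⁻ (λ Q → ¬? (e ∈? Q)) Q∈
  ... | Q∈Ps , e∉Q with find (All.lookup hs Q∈Ps)
  ... | e′ , e′∈Q , e′∈S = lose e′∈Q (∈-delete e′∈S λ { refl → e∉Q e′∈Q })

-- Bounded search tree: a hitting set must contain an edge of the first path, so each of these is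
-- tried in turn, the paths through it are discarded, and the search continues with budget `t`.
hittable? : ∀ t Ps → Dec (Hittable t Ps)
hittable? t       []       = yes ([] , z≤n , [])
hittable? zero    (P ∷ Ps) = no λ { ([] , _ , h ∷ _) → case find h of λ { (_ , _ , ()) } }
hittable? (suc t) (P ∷ Ps) = map′ branch unbranch (any? (λ e → hittable? t (avoiding e Ps)) P)

head-filter : ∀ {A : Set} {P : A → Set} (P? : Decidable P) {x} → P x → (∀ {y} → P y → y ≡ x) →
  ∀ {xs} → x ∈ xs → head (filter P? xs) ≡ just x
head-filter P? px only {y ∷ _} x∈ with P? y
... | yes py = cong just (only py)
head-filter P? px only (here refl) | no ¬px = contradiction px ¬px
head-filter P? px only (there x∈)  | no _   = head-filter P? px only x∈

-- The protocol

-- Sorted, so that both orientations of an undirected edge give the same pair. It works on bare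
-- numbers because a node knows the far part of a path only as reported codes.
edge : ℕ → ℕ → Edge
edge a b = a ⊓ b , a ⊔ b

-- On the wire and in parent pointers, 0 means "nothing" and suc x means x.
encode : Maybe (ℕ × ℕ) → ℕ
encode nothing        = 0
encode (just (_ , m)) = suc m

relay : (ℕ → ℕ) → ℕ → ℕ
relay f zero    = zero
relay f (suc w) = f w

module Listening (inp : LocalInput) where
  open LocalInput inp

  -- Each subgraph owns a block of `LIn + LIn` consecutive rounds: the first half floods, the second
  -- half reports paths.
  floodRound pathRound : Fin ℓIn → ℕ → ℕ
  floodRound i d = (LIn + LIn) * toℕ i + d
  pathRound  i j = floodRound i (LIn + j)

  hear : ℕ → ℕ → Maybe (ℕ × ℕ)
  hear w zero    = nothing
  hear w (suc m) = just (suc w , m)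

  firstHeard : Fin ℓIn → (ℕ → ℕ) → List ℕ → Maybe (ℕ × ℕ)
  firstHeard i f []       = nothing
  firstHeard i f (w ∷ ws) =
    (if inCover w i then hear w (f w) else nothing) <∣> firstHeard i f ws

  -- Ties the arithmetic round numbers to `combine`, so that `remQuot` can decode them in `emit`.
  toℕ-slot : ∀ i (j : Fin (LIn + LIn)) {d} → toℕ j ≡ d → floodRound i d ≡ toℕ (combine i j)
  toℕ-slot i j j≡d = sym (trans (toℕ-combine i j) (cong ((LIn + LIn) * toℕ i +_) j≡d))

  floodRound-slot : ∀ i {d} (d<L : d < LIn) → floodRound i d ≡ toℕ (combine i (fromℕ< d<L ↑ˡ LIn))
  floodRound-slot i d<L = toℕ-slot i _ (trans (toℕ-↑ˡ (fromℕ< d<L) LIn) (toℕ-fromℕ< d<L))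

  pathRound-slot : ∀ i {j} (j<L : j < LIn) → pathRound i j ≡ toℕ (combine i (LIn ↑ʳ fromℕ< j<L))
  pathRound-slot i j<L =
    toℕ-slot i _ (trans (toℕ-↑ʳ LIn (fromℕ< j<L)) (cong (LIn +_) (toℕ-fromℕ< j<L)))

  floodRound< : ∀ i {d} → d < LIn → floodRound i d < ℓIn * (LIn + LIn)
  floodRound< i d<L = subst (_< ℓIn * (LIn + LIn)) (sym (floodRound-slot i d<L)) (toℕ<n _)

  pathRound< : ∀ i {j} → j < LIn → pathRound i j < ℓIn * (LIn + LIn)
  pathRound< i j<L = subst (_< ℓIn * (LIn + LIn)) (sym (pathRound-slot i j<L)) (toℕ<n _)

  firstHeard⁻ : ∀ i f ws {p m} → firstHeard i f ws ≡ just (p , m) →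
    ∃[ w ] (w ∈ ws × T (inCover w i) × p ≡ suc w × f w ≡ suc m)
  firstHeard⁻ i f (w ∷ ws) eq with inCover w i in c | f w in fw
  ... | true  | suc m with refl ← eq = w , here refl , subst T (sym c) _ , refl , fw
  ... | true  | zero  = let w′ , w′∈ , rest = firstHeard⁻ i f ws eq in w′ , there w′∈ , rest
  ... | false | _     = let w′ , w′∈ , rest = firstHeard⁻ i f ws eq in w′ , there w′∈ , rest

  firstHeard⁺ : ∀ i f {ws w m} → w ∈ ws → T (inCover w i) → f w ≡ suc m →
    ∃[ x ] (firstHeard i f ws ≡ just x)
  firstHeard⁺ i f {w′ ∷ ws} (here refl) c fw with inCover w′ i | f w′
  firstHeard⁺ i f {w′ ∷ ws} (here refl) c refl | true | suc m = _ , refl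
  firstHeard⁺ i f {w′ ∷ ws} (there w∈) c fw with inCover w′ i | f w′
  ... | true  | suc m = _ , refl
  ... | true  | zero  = firstHeard⁺ i f w∈ c fw
  ... | false | _     = firstHeard⁺ i f w∈ c fw

  firstHeard-cong : ∀ i {f g} → (∀ w → f w ≡ g w) → ∀ ws → firstHeard i f ws ≡ firstHeard i g ws
  firstHeard-cong i f≗g []       = refl
  firstHeard-cong i f≗g (w ∷ ws) rewrite f≗g w | firstHeard-cong i f≗g ws = refl

module Protocol (inp : LocalInput) (hist : ℕ → ℕ → ℕ) where
  open LocalInput inp
  open Listening inp public

  -- The pair of parent pointer and message held after d rounds of flooding Gᵢ.
  flood : Fin ℓIn → ℕ → Maybe (ℕ × ℕ)
  flood i zero    = Maybe.map (0 ,_) srcMsg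
  flood i (suc d) = flood i d <∣> firstHeard i (hist (floodRound i d)) nbrs

  parent : Fin ℓIn → ℕ
  parent i = maybe′ proj₁ 0 (flood i LIn)

  -- In path round `j` the parent sends its own `ancestor i j`, which is one generation further from
  -- the receiving node; hence the index grows by one per round.
  ancestor : Fin ℓIn → ℕ → ℕ
  ancestor i zero    = parent i
  ancestor i (suc j) = relay (hist (pathRound i j)) (parent i)

  trail : Fin ℓIn → ℕ → ℕ
  trail i zero    = suc myId
  trail i (suc j) = ancestor i j

  proper? : ∀ i j → Dec (trail i (suc j) ≢ 0)
  proper? i j = ¬? (trail i (suc j) ≟ 0)

  link : Fin ℓIn → ℕ → Edge
  link i j = edge (trail i j) (trail i (suc j))

  -- Forged reports may become nonzero again after a zero, so every position is tested separately
  -- instead of cutting the trail at its first zero.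
  path : Fin ℓIn → List Edge
  path i = map (link i) (filter (proper? i) (upTo LIn))

  message : Fin ℓIn → Maybe ℕ
  message i = Maybe.map proj₂ (flood i LIn)

  carries? : ∀ m i → Dec (message i ≡ just m)
  carries? m i = Maybeₚ.≡-dec _≟_ (message i) (just m)

  pathsOf : ℕ → List (List Edge)
  pathsOf m = map path (filter (carries? m) (allFin ℓIn))

  Accepted : ℕ → Set
  Accepted m = ¬ Hittable tIn (pathsOf m)

  accepted? : ∀ m → Dec (Accepted m)
  accepted? m = ¬? (hittable? tIn (pathsOf m))

  -- Only messages that actually arrived in some subgraph are candidates, which keeps the search
  -- finite.
  output : Maybe ℕ
  output = srcMsg <∣> head (filter accepted? (mapMaybe message (allFin ℓIn)))

  slotMessage : Fin ℓIn × Fin (LIn + LIn) → ℕ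
  slotMessage (i , j) = [ encode ∘ flood i ∘ toℕ , ancestor i ∘ toℕ ]′ (splitAt LIn j)

  emit : ℕ → ℕ
  emit r with r <? ℓIn * (LIn + LIn)
  ... | yes r<R = slotMessage (remQuot (LIn + LIn) (fromℕ< r<R))
  ... | no  _   = 0

  emit-slot : ∀ i j {r} → r ≡ toℕ (combine i j) → emit r ≡ slotMessage (i , j)
  emit-slot i j {r} r≡ with r <? ℓIn * (LIn + LIn)
  ... | yes r<R = cong slotMessage
          (trans (cong (remQuot (LIn + LIn)) (toℕ-injective (trans (toℕ-fromℕ< r<R) r≡)))
                 (remQuot-combine i j))
  ... | no  r≮R = contradiction (subst (_< ℓIn * (LIn + LIn)) (sym r≡) (toℕ<n (combine i j))) r≮R

  emit-flood : ∀ i {d} → d < LIn → emit (floodRound i d) ≡ encode (flood i d)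
  emit-flood i d<L = trans (emit-slot i _ (floodRound-slot i d<L))
    (trans (cong [ encode ∘ flood i ∘ toℕ , ancestor i ∘ toℕ ]′ (splitAt-↑ˡ LIn (fromℕ< d<L) LIn))
           (cong (encode ∘ flood i) (toℕ-fromℕ< d<L)))

  emit-path : ∀ i {j} → j < LIn → emit (pathRound i j) ≡ ancestor i j
  emit-path i j<L = trans (emit-slot i _ (pathRound-slot i j<L))
    (trans (cong [ encode ∘ flood i ∘ toℕ , ancestor i ∘ toℕ ]′ (splitAt-↑ʳ LIn LIn (fromℕ< j<L)))
           (cong (ancestor i) (toℕ-fromℕ< j<L)))

  -- `<∣>` prefers its left argument, so a pair once held is never replaced.
  flood-mono : ∀ i {d d′ x} → d ≤ d′ → flood i d ≡ just x → flood i d′ ≡ just x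
  flood-mono i {d} {zero}   z≤n  eq = eq
  flood-mono i {d} {suc d′} d≤d′ eq with m≤n⇒m<n∨m≡n d≤d′
  ... | inj₂ refl       = eq
  ... | inj₁ (s≤s d≤d″) rewrite flood-mono i d≤d″ eq = refl

  message-flood : ∀ i {p m} → flood i LIn ≡ just (p , m) → message i ≡ just m
  message-flood i eq rewrite eq = refl

  parent-flood : ∀ i {d p m} → d ≤ LIn → flood i d ≡ just (p , m) → parent i ≡ p
  parent-flood i d≤L eq rewrite flood-mono i d≤L eq = refl

  parent-new : ∀ i {d p m} → d < LIn → flood i d ≡ nothing →
    firstHeard i (hist (floodRound i d)) nbrs ≡ just (p , m) → parent i ≡ p
  parent-new i {d} {p} {m} d<L none eq = parent-flood i d<L new
    where
    new : flood i (suc d) ≡ just (p , m)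
    new rewrite none = eq

-- Sent values depend only on earlier rounds

module _ (inp : LocalInput) {h h′ : ℕ → ℕ → ℕ} where
  open LocalInput inp
  private
    module P  = Protocol inp h
    module P′ = Protocol inp h′

  -- A node sends from the history it has so far, while the analysis uses final histories. The two
  -- agree on all rounds that the sent value depends on.
  flood-local : ∀ i d → (∀ r → r < P.floodRound i d → h r ≡ h′ r) → P.flood i d ≡ P′.flood i d
  flood-local i zero    _     = refl
  flood-local i (suc d) agree = cong₂ _<∣>_
    (flood-local i d (λ r r< → agree r (<-≤-trans r< (+-monoʳ-≤ ((LIn + LIn) * toℕ i) (n≤1+n d)))))
    (P.firstHeard-cong i
      (λ w → cong (λ f → f w) (agree _ (+-monoʳ-< ((LIn + LIn) * toℕ i) (n<1+n d)))) nbrs)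

  parent-local : ∀ i j → (∀ r → r < P.pathRound i j → h r ≡ h′ r) → P.parent i ≡ P′.parent i
  parent-local i j agree = cong (maybe′ proj₁ 0) (flood-local i LIn λ r r< →
    agree r (<-≤-trans r< (+-monoʳ-≤ ((LIn + LIn) * toℕ i) (m≤m+n LIn j))))

  ancestor-local : ∀ i j → (∀ r → r < P.pathRound i j → h r ≡ h′ r) →
    P.ancestor i j ≡ P′.ancestor i j
  ancestor-local i zero    agree = parent-local i zero agree
  ancestor-local i (suc j) agree = cong₂ relay
    (agree _ (+-monoʳ-< ((LIn + LIn) * toℕ i) (+-monoʳ-< LIn (n<1+n j))))
    (parent-local i (suc j) agree)

-- The state records the whole history of received messages; all decisions are functions of it.
record NodeState : Set where
  constructor node
  field
    input : LocalInput
    round : ℕ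
    hist  : ℕ → ℕ → ℕ

remember : ℕ → (ℕ → ℕ) → (ℕ → ℕ → ℕ) → ℕ → ℕ → ℕ
remember r f h r′ with r′ ≟ r
... | yes _ = f
... | no  _ = h r′

remember-new : ∀ r {f h} → remember r f h r ≡ f
remember-new r with r ≟ r
... | yes _  = refl
... | no r≢r = contradiction refl r≢r

remember-old : ∀ {r r′ f h} → r′ < r → remember r f h r′ ≡ h r′
remember-old {r} {r′} r′<r with r′ ≟ r
... | yes refl = contradiction r′<r (<-irrefl refl)
... | no _     = refl

protocol : Algorithm
protocol = record
  { State = NodeState
  ; init  = λ inp → node inp 0 (λ _ _ → 0)
  ; send  = λ { (node inp r h) _ → Protocol.emit inp h r }
  ; recv  = λ { (node inp r h) f → node inp (suc r) (remember r f h) }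
  ; out   = λ { (node inp r h) → Protocol.output inp h }
  }

-- Edge sets as lists of coded edges

edge-comm : ∀ a b → edge a b ≡ edge b a
edge-comm a b = cong₂ _,_ (⊓-comm a b) (⊔-comm a b)

edge-≤ : ∀ {a b} → a ≤ b → edge a b ≡ (a , b)
edge-≤ a≤b = cong₂ _,_ (m≤n⇒m⊓n≡m a≤b) (m≤n⇒m⊔n≡n a≤b)

edge-sorted : ∀ a b → edge a b ≡ (a , b) ⊎ edge a b ≡ (b , a)
edge-sorted a b with ≤-total a b
... | inj₁ a≤b = inj₁ (edge-≤ a≤b)
... | inj₂ b≤a = inj₂ (trans (edge-comm a b) (edge-≤ b≤a))

edge-injective : ∀ {a b c d} → edge a b ≡ edge c d → (a ≡ c × b ≡ d) ⊎ (a ≡ d × b ≡ c)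
edge-injective {a} {b} {c} {d} eq with edge-sorted a b | edge-sorted c d
... | inj₁ p | inj₁ q with refl ← trans (sym p) (trans eq q) = inj₁ (refl , refl)
... | inj₁ p | inj₂ q with refl ← trans (sym p) (trans eq q) = inj₂ (refl , refl)
... | inj₂ p | inj₁ q with refl ← trans (sym p) (trans eq q) = inj₂ (refl , refl)
... | inj₂ p | inj₂ q with refl ← trans (sym p) (trans eq q) = inj₁ (refl , refl)

length-filter-map : ∀ {A C : Set} {P : C → Set} (P? : Decidable P) (f : A → C) xs →
  length (filter P? (map f xs)) ≡ sum (map (λ x → if does (P? (f x)) then 1 else 0) xs)
length-filter-map P? f []       = refl
length-filter-map P? f (x ∷ xs) with P? (f x)
... | yes _ = cong suc (length-filter-map P? f xs)
... | no  _ = length-filter-map P? f xs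

length-filter-product : ∀ {A C : Set} {P : A × C → Set} (P? : Decidable P) xs ys →
  length (filter P? (cartesianProduct xs ys)) ≡
  sum (map (λ x → sum (map (λ y → if does (P? (x , y)) then 1 else 0) ys)) xs)
length-filter-product P? []       ys = refl
length-filter-product P? (x ∷ xs) ys = begin
  length (filter P? (map (x ,_) ys ++ cartesianProduct xs ys))
    ≡⟨ cong length (filter-++ P? (map (x ,_) ys) _) ⟩
  length (filter P? (map (x ,_) ys) ++ filter P? (cartesianProduct xs ys))
    ≡⟨ length-++ (filter P? (map (x ,_) ys)) ⟩
  length (filter P? (map (x ,_) ys)) + length (filter P? (cartesianProduct xs ys))
    ≡⟨ cong₂ _+_ (length-filter-map P? (x ,_) ys) (length-filter-product P? xs ys) ⟩
  _ ∎
  where open ≡-Reasoning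

module CodedEdges {n} (ID : Fin n → ℕ) (ID-inj : Injective _≡_ _≡_ ID) where

  code : Fin n → ℕ
  code v = suc (ID v)

  code-injective : ∀ {u v} → code u ≡ code v → u ≡ v
  code-injective = ID-inj ∘ suc-injective

  codeEdge : Fin n × Fin n → Edge
  codeEdge (u , v) = edge (code u) (code v)

  -- This is the very condition summed in `edgeCount`, so the length of the filtered list unfolds to
  -- that double sum.
  oriented? : (X : EdgeSet n) (e : Fin n × Fin n) →
    Dec (T ((toℕ (proj₁ e) <ᵇ toℕ (proj₂ e)) ∧ X (proj₁ e) (proj₂ e)))
  oriented? X _ = T? _

  orientedEdges : EdgeSet n → List (Fin n × Fin n)
  orientedEdges X = filter (oriented? X) (cartesianProduct (allFin n) (allFin n))

  edgeList : EdgeSet n → List Edge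
  edgeList X = map codeEdge (orientedEdges X)

  length-edgeList : ∀ X → length (edgeList X) ≡ edgeCount X
  length-edgeList X = trans (length-map codeEdge (orientedEdges X))
    (length-filter-product (oriented? X) (allFin n) (allFin n))

  ∈-orientedEdges⁻ : ∀ X {u v} → (u , v) ∈ orientedEdges X → toℕ u < toℕ v × T (X u v)
  ∈-orientedEdges⁻ X {u} {v} uv∈ =
    let u<v , Xuv = Equivalence.to T-∧ (proj₂ (∈-filter⁻ (oriented? X) {xs = cartesianProduct (allFin n) (allFin n)} uv∈))
    in <ᵇ⇒< (toℕ u) (toℕ v) u<v , Xuv

  ∈-edgeList : ∀ X {u v} → (∀ u v → X u v ≡ X v u) → (∀ u → ¬ T (X u u)) →
    T (X u v) → codeEdge (u , v) ∈ edgeList X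
  ∈-edgeList X {u} {v} X-sym X-irrefl Xuv with <-cmp (toℕ u) (toℕ v)
  ... | tri< u<v _ _ = ∈-map⁺ codeEdge (∈-filter⁺ (oriented? X)
          (∈-cartesianProduct⁺ (∈-allFin u) (∈-allFin v)) (Equivalence.from T-∧ (<⇒<ᵇ u<v , Xuv)))
  ... | tri> _ _ v<u = subst (_∈ edgeList X) (edge-comm (code v) (code u))
          (∈-map⁺ codeEdge (∈-filter⁺ (oriented? X)
            (∈-cartesianProduct⁺ (∈-allFin v) (∈-allFin u))
            (Equivalence.from T-∧ (<⇒<ᵇ v<u , subst T (X-sym u v) Xuv))))
  ... | tri≈ _ u≡v _ with refl ← toℕ-injective u≡v = contradiction Xuv (X-irrefl u)

  -- `codeEdge` identifies a pair with its swap, but of two swapped pairs at most one is oriented,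
  -- so it is injective on oriented edges.
  unique-map : ∀ X {es} → Unique es → (∀ {e} → e ∈ es → e ∈ orientedEdges X) →
    Unique (map codeEdge es)
  unique-map X []           _   = []
  unique-map X {(u , v) ∷ es} (e∉ ∷ unique) es⊆ =
    All.tabulate distinct ∷ unique-map X unique (es⊆ ∘ there)
    where
    distinct : ∀ {e} → e ∈ map codeEdge es → codeEdge (u , v) ≢ e
    distinct e∈ uv≡e with ∈-map⁻ codeEdge e∈
    ... | (u′ , v′) , e′∈ , refl with edge-injective {code u} {code v} {code u′} {code v′} uv≡e
    ... | inj₁ (p , q) = All.lookup e∉ e′∈ (cong₂ _,_ (code-injective p) (code-injective q))
    ... | inj₂ (p , q) with refl ← code-injective {u} {v′} p | refl ← code-injective {v} {u′} q =
      <-asym (proj₁ (∈-orientedEdges⁻ X (es⊆ (here refl)))) (proj₁ (∈-orientedEdges⁻ X (es⊆ (there e′∈))))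

  -- The codes of the oriented edges are distinct members of `S`; `S` may contain repetitions and
  -- further pairs.
  edgeCount≤ : ∀ X {S} → (∀ {u v} → T (X u v) → codeEdge (u , v) ∈ S) → edgeCount X ≤ length S
  edgeCount≤ X {S} X⊆S = subst (_≤ length S) (length-edgeList X)
    (unique-⊆⇒length≤
      (unique-map X (Uniqueₚ.filter⁺ (oriented? X)
        (Uniqueₚ.cartesianProduct⁺ (Uniqueₚ.allFin⁺ n) (Uniqueₚ.allFin⁺ n))) (λ e∈ → e∈))
      λ e∈ → case ∈-map⁻ codeEdge e∈ of λ
        { ((u , v) , e∈′ , refl) → X⊆S (proj₂ (∈-orientedEdges⁻ X e∈′)) })

-- Executions against the adversary

clip-< : ∀ {bound m} → m < bound → clip bound m ≡ m
clip-< {bound} {m} m<b with m <? bound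
... | yes _  = refl
... | no m≮b = contradiction m<b m≮b

clip-zero : ∀ bound → clip bound 0 ≡ 0
clip-zero bound with 0 <? bound
... | yes _ = refl
... | no  _ = refl

-- An oversized value is replaced by 0, so a nonzero result is the value that was sent.
clip-suc : ∀ {bound x m} → clip bound x ≡ suc m → x ≡ suc m
clip-suc {bound} {x} eq with x <? bound
... | yes _ = eq

firstWith-unique : ∀ {n} {p : Fin n → Bool} {f : Fin n → ℕ} {v vs} → v ∈ vs → T (p v) →
  (∀ w → T (p w) → w ≡ v) → firstWith vs p f ≡ f v
firstWith-unique {p = p} {vs = w ∷ vs} v∈ pv only with p w in pw
... | true = cong _ (only w (subst T (sym pw) _))
firstWith-unique {p = p} (here refl) pv only | false = ⊥-elim (subst T pw pv)
firstWith-unique (there v∈)  pv only | false = firstWith-unique v∈ pv only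

module _ {A C : Set} (p : A → Bool) (f : A → C) where
  private
    collect : List A → List C
    collect = foldr (λ x acc → if p x then f x ∷ acc else acc) []

  ∈-collect⁺ : ∀ {x xs} → x ∈ xs → T (p x) → f x ∈ collect xs
  ∈-collect⁺ {xs = y ∷ xs} (here refl) px with p y
  ... | true = here refl
  ∈-collect⁺ {xs = y ∷ xs} (there x∈) px with p y
  ... | true  = there (∈-collect⁺ x∈ px)
  ... | false = ∈-collect⁺ x∈ px

  ∈-collect⁻ : ∀ {z} xs → z ∈ collect xs → ∃[ x ] (T (p x) × z ≡ f x)
  ∈-collect⁻ (y ∷ xs) z∈ with p y in py
  ∈-collect⁻ (y ∷ xs) (here refl) | true  = y , subst T (sym py) _ , refl
  ∈-collect⁻ (y ∷ xs) (there z∈)  | true  = ∈-collect⁻ xs z∈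
  ∈-collect⁻ (y ∷ xs) z∈          | false = ∈-collect⁻ xs z∈

module Execution {n} (I : Instance n) (B : ℕ) (F : EdgeSet n) (adv : ℕ → Fin n → Fin n → ℕ)
  where

  bound : ℕ
  bound = N I ^ B

  exec : ℕ → Fin n → NodeState
  exec = execute protocol I B F adv

  heard : ℕ → Fin n → ℕ → ℕ
  heard r u w = firstWith (allFin n) (λ v → (ID I v ≡ᵇ w) ∧ adj (graph I) u v)
    (λ v → clip bound (if F v u then adv r v u else send protocol (exec r v) (ID I u)))

  history : ℕ → Fin n → ℕ → ℕ → ℕ
  history zero    u = λ _ _ → 0
  history (suc r) u = remember r (heard r u) (history r u)

  exec-node : ∀ r u → exec r u ≡ node (localInput I u) r (history r u)
  exec-node zero    u = refl
  exec-node (suc r) u = cong (λ s → recv protocol s (heard r u)) (exec-node r u)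

  srcMsg-src : LocalInput.srcMsg (localInput I (src I)) ≡ just (m₀ I)
  srcMsg-src with src I ≟ᶠ src I
  ... | yes _ = refl
  ... | no ≢  = contradiction refl ≢

  srcMsg-other : ∀ {u} → u ≢ src I → LocalInput.srcMsg (localInput I u) ≡ nothing
  srcMsg-other {u} u≢s with u ≟ᶠ src I
  ... | yes u≡s = contradiction u≡s u≢s
  ... | no _    = refl

  history-heard : ∀ {r r′} u → r < r′ → history r′ u r ≡ heard r u
  history-heard {r} {suc r′} u (s≤s r≤r′) with m≤n⇒m<n∨m≡n r≤r′
  ... | inj₁ r<r′ = trans (remember-old r<r′) (history-heard u r<r′)
  ... | inj₂ refl = remember-new r

-- Analysis of one execution through the histories after round `R`

module Analysis {n} (I : Instance n) (B : ℕ) (F : EdgeSet n) (adv : ℕ → Fin n → Fin n → ℕ)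
  (ID-inj : Injective _≡_ _≡_ (ID I))
  (F-edges : IsEdgeSubset (graph I) F)
  (ID-small : ∀ u → suc (ID I u) < N I ^ B)
  (m₀-small : suc (m₀ I) < N I ^ B)
  (fam-edges : ∀ i → IsEdgeSubset (graph I) (fam I i))
  (R : ℕ) (R-covers : ℓ I * (L I + L I) ≤ R)
  where

  open Execution I B F adv
  open CodedEdges (ID I) ID-inj

  history-agree : ∀ {r} u → r ≤ R → ∀ r′ → r′ < r → history r u r′ ≡ history R u r′
  history-agree u r≤R r′ r′<r =
    trans (history-heard u r′<r) (sym (history-heard u (<-≤-trans r′<r r≤R)))

  module P (u : Fin n) = Protocol (localInput I u) (history R u)

  only-ID : ∀ {u v} w → T ((ID I w ≡ᵇ ID I v) ∧ adj (graph I) u w) → w ≡ v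
  only-ID {u} {v} w h = ID-inj (≡ᵇ⇒≡ (ID I w) (ID I v) (proj₁ (Equivalence.to T-∧ h)))

  is-ID : ∀ {u v} → T (adj (graph I) u v) → T ((ID I v ≡ᵇ ID I v) ∧ adj (graph I) u v)
  is-ID {u} {v} uv = Equivalence.from T-∧ (≡⇒≡ᵇ (ID I v) (ID I v) refl , uv)

  heard-honest : ∀ r {u v} → T (adj (graph I) u v) → ¬ T (F v u) →
    heard r u (ID I v) ≡ clip bound (Protocol.emit (localInput I v) (history r v) r)
  heard-honest r {u} {v} uv ¬F =
    trans (firstWith-unique (∈-allFin v) (is-ID uv) only-ID) (cong (clip bound) honest)
    where
    honest : (if F v u then adv r v u else send protocol (exec r v) (ID I u)) ≡
             Protocol.emit (localInput I v) (history r v) r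
    honest with F v u
    ... | true  = contradiction _ ¬F
    ... | false = cong (λ s → send protocol s (ID I u)) (exec-node r v)

  history-honest : ∀ {r u v} → r < R → T (adj (graph I) u v) → ¬ T (F v u) →
    history R u r (ID I v) ≡ clip bound (Protocol.emit (localInput I v) (history r v) r)
  history-honest {r} {u} {v} r<R uv ¬F =
    trans (cong (λ f → f (ID I v)) (history-heard u r<R)) (heard-honest r uv ¬F)

  hear-flood : ∀ i {u v d} → d < L I → T (adj (graph I) u v) → ¬ T (F v u) →
    history R u (P.floodRound u i d) (ID I v) ≡ clip bound (encode (P.flood v i d))
  hear-flood i {u} {v} {d} d<L uv ¬F = trans (history-honest r<R uv ¬F)
    (cong (clip bound)
      (trans (Protocol.emit-flood (localInput I v) _ i d<L)
             (cong encode (flood-local (localInput I v) i d (history-agree v (<⇒≤ r<R))))))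
    where r<R = <-≤-trans (P.floodRound< u i d<L) R-covers

  hear-path : ∀ i {u v j} → j < L I → T (adj (graph I) u v) → ¬ T (F v u) →
    history R u (P.pathRound u i j) (ID I v) ≡ clip bound (P.ancestor v i j)
  hear-path i {u} {v} {j} j<L uv ¬F = trans (history-honest r<R uv ¬F)
    (cong (clip bound)
      (trans (Protocol.emit-path (localInput I v) _ i j<L)
             (ancestor-local (localInput I v) i j (history-agree v (<⇒≤ r<R)))))
    where r<R = <-≤-trans (P.pathRound< u i j<L) R-covers

  inCover-fam : ∀ i {u v} → T (adj (graph I) u v) →
    LocalInput.inCover (localInput I u) (ID I v) i ≡ fam I i u v
  inCover-fam i {u} {v} uv = trans
    (cong (_≡ᵇ 1) (firstWith-unique {f = λ v → if fam I i u v then 1 else 0}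
                     (∈-allFin v) (is-ID uv) only-ID))
    (indicator (fam I i u v))
    where
    indicator : ∀ b → ((if b then 1 else 0) ≡ᵇ 1) ≡ b
    indicator true  = refl
    indicator false = refl

  -- Across an honest edge, what the parent reports is its own trail, so the child's trail is the
  -- parent's moved by one place. `clip` is removed only later, where the entry is known to be a
  -- code or 0.
  trail-shift : ∀ i {u v j} → P.parent u i ≡ code v → T (adj (graph I) u v) → ¬ T (F v u) →
    j ≤ L I → P.trail u i (suc j) ≡ clip bound (P.trail v i j)
  trail-shift i {v = v} {zero}  par uv ¬F _   = trans par (sym (clip-< (ID-small v)))
  trail-shift i {j = suc j} par uv ¬F j<L rewrite par = hear-path i j<L uv ¬F

  clip-code : ∀ {x v} → x ≡ code v → clip bound x ≡ code v
  clip-code {v = v} refl = clip-< (ID-small v)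

  Link : Fin (ℓ I) → ℕ → ℕ → Set
  Link i a b = ∃[ x ] ∃[ y ] (T (fam I i x y) × a ≡ code x × b ≡ code y)

  -- Membership in the subgraph is recorded too, so that its disjointness from `F` excludes such
  -- links.
  FaultyLink : Fin (ℓ I) → ℕ → ℕ → Set
  FaultyLink i a b = ∃[ x ] ∃[ y ] (T (F x y) × T (fam I i x y) × a ≡ code x × b ≡ code y)

  -- In `d` rounds a message crosses at most `d` links. For `d = L I` the bound on `j` places the
  -- link among the positions that `path` inspects.
  Faulty : Fin n → Fin (ℓ I) → ℕ → Set
  Faulty u i d = ∃[ j ] (j < d × FaultyLink i (P.trail u i j) (P.trail u i (suc j)))

  -- The alternative 0 covers the positions beyond the source, which `path` drops.
  Honest : Fin n → Fin (ℓ I) → ℕ → Set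
  Honest u i m = m ≡ m₀ I ×
    (∀ {j} → j < L I → P.trail u i (suc j) ≡ 0 ⊎ Link i (P.trail u i j) (P.trail u i (suc j)))

  honest-source : ∀ i → Honest (src I) i (m₀ I)
  honest-source i = refl , λ {j} _ → inj₁ (ends j)
    where
    parent-source : P.parent (src I) i ≡ 0
    parent-source = P.parent-flood (src I) i z≤n (cong (Maybe.map (0 ,_)) srcMsg-src)
    ends : ∀ j → P.trail (src I) i (suc j) ≡ 0
    ends zero    = parent-source
    ends (suc j) rewrite parent-source = refl

  -- Up to its first adversarial edge the trail is what the nodes on it really recorded; a trail
  -- without adversarial edges therefore leads back to the source.
  trace : ∀ i d {u p m} → d ≤ L I → P.flood u i d ≡ just (p , m) → Faulty u i d ⊎ Honest u i m
  trace i zero {u} d≤L eq with u ≟ᶠ src I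
  trace i zero {u} d≤L refl | yes refl = inj₂ (honest-source i)
  trace i (suc d) {u} {p} {m} d<L eq with P.flood u i d in floods
  trace i (suc d) {u} d<L refl | just _ with trace i d (<⇒≤ d<L) floods
  ... | inj₁ (j , j<d , link) = inj₁ (j , m≤n⇒m≤1+n j<d , link)
  ... | inj₂ honest           = inj₂ honest
  trace i (suc d) {u} {p} {m} d<L eq | nothing
    with P.firstHeard⁻ u i _ (neighbourIds (graph I) (ID I) u) eq
  ... | w , w∈ , covered , refl , hw
    with ∈-collect⁻ (adj (graph I) u) (ID I) (allFin n) w∈
  ... | v , uv , refl with T? (F v u)
  -- The message may be forged, but then the first link of the trail is itself adversarial. It lies
  -- in the subgraph because `firstHeard` listens only to edges of it.
  ... | yes Fvu = inj₁ (0 , s≤s z≤n , u , v , subst T (proj₁ F-edges v u) Fvu ,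
                        subst T (inCover-fam i uv) covered , refl , par)
    where
    par : P.parent u i ≡ code v
    par = P.parent-new u i d<L floods eq
  -- A nonzero value received over an honest edge was not cut, so `v` held `m` after `d` rounds and
  -- the induction hypothesis applies to `v`.
  ... | no ¬F = shift (trace i d (<⇒≤ d<L) (encode-just (clip-suc (trans (sym (hear-flood i d<L uv ¬F)) hw))))
    where
    par : P.parent u i ≡ code v
    par = P.parent-new u i d<L floods eq
    encode-just : ∀ {x} → encode x ≡ suc m → x ≡ just (maybe′ proj₁ 0 x , m)
    encode-just {just _} refl = refl
    next : ∀ {j} → j ≤ L I → P.trail u i (suc j) ≡ clip bound (P.trail v i j)
    next = trail-shift i par uv ¬F
    shift : ∀ {m} → Faulty v i d ⊎ Honest v i m → Faulty u i (suc d) ⊎ Honest u i m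
    shift (inj₁ (j , j<d , x , y , Fxy , Gxy , jx , jy)) =
      inj₁ (suc j , s≤s j<d , x , y , Fxy , Gxy ,
            trans (next (<⇒≤ j<L)) (clip-code jx) , trans (next j<L) (clip-code jy))
      where j<L = <-trans j<d d<L
    shift (inj₂ (m≡ , links)) = inj₂ (m≡ , links′)
      where
      links′ : ∀ {j} → j < L I →
        P.trail u i (suc j) ≡ 0 ⊎ Link i (P.trail u i j) (P.trail u i (suc j))
      links′ {zero}  _   = inj₂ (u , v , subst T (inCover-fam i uv) covered , refl , par)
      links′ {suc j} j<L with links (<⇒≤ j<L)
      ... | inj₁ end = inj₁ (trans (next (<⇒≤ j<L)) (trans (cong (clip bound) end) (clip-zero bound)))
      ... | inj₂ (x , y , Gxy , jx , jy) =
        inj₂ (x , y , Gxy , trans (next (<⇒≤ (<⇒≤ j<L))) (clip-code jx) , trans (next (<⇒≤ j<L)) (clip-code jy))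

  -- Flooding through a subgraph without adversarial edges

  module _ {i} (F∩Gᵢ=∅ : Disjoint F (fam I i)) where

    honest : ∀ {u d p m} → d ≤ L I → P.flood u i d ≡ just (p , m) → Honest u i m
    honest {d = d} d≤L eq with trace i d d≤L eq
    ... | inj₁ (_ , _ , x , y , Fxy , Gxy , _) = ⊥-elim (F∩Gᵢ=∅ x y Fxy Gxy)
    ... | inj₂ h                               = h

    -- Induction along the walk: the next node holds the message one round earlier and passes it on,
    -- unless `u` already heard from elsewhere. Either way `honest` forces the message held to be
    -- `m₀ I`.
    reach : ∀ {H u k} (w : Walk H u (src I) k) → WalkIn w (fam I i) → k ≤ L I →
      ∃[ p ] (P.flood u i k ≡ just (p , m₀ I))
    reach (here _) _ _ = 0 , cong (Maybe.map (0 ,_)) srcMsg-src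
    reach {u = u} {suc k} (step {w = v} _ w) (uv∈Gᵢ , w⊆Gᵢ) k<L =
      let _ , v-has = reach w w⊆Gᵢ (<⇒≤ k<L)
          (p , m) , u-has = arrives v-has
      in p , trans u-has (cong (λ m → just (p , m)) (proj₁ (honest k<L u-has)))
      where
      uv : T (adj (graph I) u v)
      uv = proj₂ (fam-edges i) u v uv∈Gᵢ
      ¬Fvu : ¬ T (F v u)
      ¬Fvu Fvu = F∩Gᵢ=∅ v u Fvu (subst T (proj₁ (fam-edges i) u v) uv∈Gᵢ)
      arrives : ∀ {q} → P.flood v i k ≡ just (q , m₀ I) → ∃[ x ] (P.flood u i (suc k) ≡ just x)
      arrives v-has with P.flood u i k
      ... | just x  = x , refl
      ... | nothing = P.firstHeard⁺ u i _ (∈-collect⁺ (adj (graph I) u) (ID I) (∈-allFin v) uv)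
        (subst T (sym (inCover-fam i uv)) uv∈Gᵢ)
        (trans (hear-flood i k<L uv ¬Fvu)
               (trans (cong (clip bound ∘ encode) v-has) (clip-< m₀-small)))

  -- Wrong messages are rejected, the right one is accepted

  module _ (F-few : edgeCount F ≤ t I) where

    F-irrefl : ∀ u → ¬ T (F u u)
    F-irrefl u Fuu = subst T (irrefl (graph I) u) (proj₂ F-edges u u Fuu)

    -- `F` itself is the hitting set: by `trace`, a wrong message leaves an adversarial link on its
    -- recorded path.
    wrong-hittable : ∀ u {m} → m ≢ m₀ I → Hittable (t I) (P.pathsOf u m)
    wrong-hittable u {m} m≢m₀ =
      edgeList F , subst (_≤ t I) (sym (length-edgeList F)) F-few , All.tabulate hits
      where
      hits : ∀ {es} → es ∈ P.pathsOf u m → Hits (edgeList F) es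
      hits es∈ with ∈-map∘filter⁻ (P.path u) (P.carries? u m) {xs = allFin (ℓ I)} es∈
      ... | i , _ , refl , carries with P.flood u i (L I) in floods
      ... | just (p , m′) with refl ← just-injective carries | trace i (L I) ≤-refl floods
      ... | inj₂ (m≡m₀ , _) = contradiction m≡m₀ m≢m₀
      ... | inj₁ (j , j<L , x , y , Fxy , _ , jx , jy) =
        lose (∈-map∘filter⁺ (P.link u i) (P.proper? u i)
               -- The far end of the link is a code, hence a successor, so `proper?` keeps this
               -- position.
               (j , ∈-upTo⁺ j<L , refl , λ zero≡ → 0≢1+n (trans (sym zero≡) jy)))
             (subst (_∈ edgeList F) (sym (cong₂ edge jx jy))
               (∈-edgeList F (proj₁ F-edges) F-irrefl Fxy))

    module _ (near : FaultDistBound (graph I) (2 * t I) (L I))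
             (covering : IsCoveringFamily (graph I) (L I) (2 * t I) (ℓ I) (fam I)) where

      -- The two halves of `2 * t I` pay for `F` and for `S`, united in `X`. Disjointness from `F`
      -- makes the flooding of the chosen subgraph correct. The recorded trail need not be the
      -- covered path, but its links lie in the same subgraph, and disjointness from `S` keeps `S`
      -- off it.
      delivered : ∀ u S → length S ≤ t I →
        ∃[ i ] (P.message u i ≡ just (m₀ I) × ¬ Hits S (P.path u i))
      delivered u S |S|≤t =
        let k , k≤L , w , simple = near X X-edges X-few u (src I)
            i , w⊆Gᵢ , X∩Gᵢ=∅ = proj₂ covering u (src I) X X-edges X-few k k≤L (w , simple)
            F∩Gᵢ=∅ = λ x y Fxy → X∩Gᵢ=∅ x y (F⊆X Fxy)
            p , u-has = reach F∩Gᵢ=∅ w w⊆Gᵢ k≤L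
        in i , P.message-flood u i (P.flood-mono u i k≤L u-has) ,
           avoids i X∩Gᵢ=∅ (proj₂ (honest F∩Gᵢ=∅ k≤L u-has))
        where
        X? : ∀ x y → Dec (codeEdge (x , y) ∈ edgeList F ++ S)
        X? x y = codeEdge (x , y) ∈? (edgeList F ++ S)
        -- `S` is an arbitrary list of number pairs, so only those coding edges of the graph are
        -- kept.
        X : EdgeSet n
        X x y = adj (graph I) x y ∧ ⌊ X? x y ⌋
        X⁺ : ∀ {x y} → T (adj (graph I) x y) → codeEdge (x , y) ∈ edgeList F ++ S → T (X x y)
        X⁺ {x} {y} xy ∈FS = Equivalence.from T-∧ (xy , fromWitness {a? = X? x y} ∈FS)
        X-edges : IsEdgeSubset (graph I) X
        X-edges = (λ x y → cong₂ _∧_ (adj-sym (graph I) x y)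
                    (cong (λ e → ⌊ e ∈? (edgeList F ++ S) ⌋) (edge-comm (code x) (code y))))
                , (λ x y → proj₁ ∘ Equivalence.to T-∧)
        X-few : edgeCount X ≤ 2 * t I
        X-few = begin
          edgeCount X                      ≤⟨ edgeCount≤ X (λ {x} {y} Xxy →
                                                toWitness {a? = X? x y} (proj₂ (Equivalence.to T-∧ Xxy))) ⟩
          length (edgeList F ++ S)         ≡⟨ length-++ (edgeList F) ⟩
          length (edgeList F) + length S   ≡⟨ cong (_+ length S) (length-edgeList F) ⟩
          -- `2 * t I` unfolds to `t I + (t I + 0)`, hence the padding by 0.
          edgeCount F + length S           ≤⟨ +-mono-≤ F-few (≤-trans |S|≤t (m≤m+n (t I) 0)) ⟩
          2 * t I                          ∎
          where open ≤-Reasoning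
        F⊆X : ∀ {x y} → T (F x y) → T (X x y)
        F⊆X {x} {y} Fxy = X⁺ (proj₂ F-edges x y Fxy)
          (∈-++⁺ˡ (∈-edgeList F (proj₁ F-edges) F-irrefl Fxy))
        avoids : ∀ i → Disjoint X (fam I i) →
          (∀ {j} → j < L I →
            P.trail u i (suc j) ≡ 0 ⊎ Link i (P.trail u i j) (P.trail u i (suc j))) →
          ¬ Hits S (P.path u i)
        avoids i X∩Gᵢ=∅ links hit with find hit
        ... | e , e∈path , e∈S with ∈-map∘filter⁻ (P.link u i) (P.proper? u i) e∈path
        ... | j , j∈ , refl , proper with links (∈-upTo⁻ j∈)
        ... | inj₁ end = proper end
        ... | inj₂ (x , y , Gxy , jx , jy) = X∩Gᵢ=∅ x y
          (X⁺ (proj₂ (fam-edges i) x y Gxy) (∈-++⁺ʳ (edgeList F) (subst (_∈ S) (cong₂ edge jx jy) e∈S)))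
          Gxy

      right-accepted : ∀ u → P.Accepted u (m₀ I)
      right-accepted u (S , |S|≤t , hits) =
        let i , carries , unhit = delivered u S |S|≤t
        in unhit (All.lookup hits (∈-map∘filter⁺ (P.path u) (P.carries? u (m₀ I)) (i , ∈-allFin i , refl , carries)))

      only-right : ∀ u {m} → P.Accepted u m → m ≡ m₀ I
      only-right u {m} accepted with m ≟ m₀ I
      ... | yes m≡m₀ = m≡m₀
      ... | no  m≢m₀ = contradiction (wrong-hittable u m≢m₀) accepted

      right-candidate : ∀ u → m₀ I ∈ mapMaybe (P.message u) (allFin (ℓ I))
      right-candidate u =
        -- With nothing to avoid, `delivered` still provides a subgraph through which the right
        -- message arrives.
        let i , carries , _ = delivered u [] z≤n
        in Anyₚ.mapMaybe⁺ (P.message u) (allFin (ℓ I)) (Anyₚ.map⁺ (lose (∈-allFin i)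
             (subst (MaybeAny.Any (m₀ I ≡_)) (sym carries) (MaybeAny.just refl))))

      correct : ∀ {u} → u ≢ src I → out protocol (exec R u) ≡ just (m₀ I)
      correct {u} u≢s rewrite exec-node R u | srcMsg-other u≢s =
        head-filter (P.accepted? u) (right-accepted u) (only-right u) (right-candidate u)

-- Bandwidth and number of rounds

distinct⇒2≤ : ∀ {n} {u v : Fin n} → u ≢ v → 2 ≤ n
distinct⇒2≤ {1} {zero} {zero} u≢v = contradiction refl u≢v
distinct⇒2≤ {suc (suc n)}     _   = s≤s (s≤s z≤n)

theorem5 : (k : ℕ) →
    Σ ℕ λ B → Σ ℕ λ c → Σ Algorithm λ A →
    ∀ (n : ℕ) (I : Instance n) →
    Injective _≡_ _≡_ (ID I) →
    (∀ u → ID I u < n ^ k) →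
    n ≤ N I → N I ≤ n ^ k →
    m₀ I < n ^ k →
    IsEdgeConnected (graph I) (2 * t I + 1) →
    FaultDistBound (graph I) (2 * t I) (L I) →
    IsCoveringFamily (graph I) (L I) (2 * t I) (ℓ I) (fam I) →
    ∀ (F : EdgeSet n) → IsEdgeSubset (graph I) F → edgeCount F ≤ t I →
    ∀ (adv : ℕ → Fin n → Fin n → ℕ) →
    ∀ (u : Fin n) → out A (execute A I B F adv (c * (L I * ℓ I)) u) ≡ just (m₀ I)
-- The exponent `suc k` leaves room for the successor in codes and encoded messages; the factor 2
-- counts `L I` flooding rounds and `L I` path rounds per subgraph.
theorem5 k = suc k , 2 , protocol , λ n I ID-inj ID<n^k n≤N _ m₀<n^k _ near covering F F-edges F-few adv u →
  case u ≟ᶠ src I of λ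
    { (yes refl) → source I F adv (2 * (L I * ℓ I))
    ; (no u≢s) →
        -- A node other than the source forces at least two nodes, which `fits` requires; the source
        -- answers from its own input.
        let small = λ {x} → fits {N = N I} {x = x} (distinct⇒2≤ u≢s) n≤N
        in Analysis.correct I (suc k) F adv ID-inj F-edges (λ v → small (ID<n^k v)) (small m₀<n^k)
             (proj₁ covering) (2 * (L I * ℓ I)) (≤-reflexive (rounds (L I) (ℓ I)))
             F-few near covering u≢s
    }
  where
  source : ∀ {n} (I : Instance n) F adv r →
    out protocol (execute protocol I (suc k) F adv r (src I)) ≡ just (m₀ I)
  source I F adv r
    rewrite Execution.exec-node I (suc k) F adv r (src I) | Execution.srcMsg-src I (suc k) F adv = refl

  -- The extra factor `N` is at least 2 and `n ^ k` is positive, so doubling `n ^ k` absorbs the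
  -- shift by one.
  fits : ∀ {n N x} → 2 ≤ n → n ≤ N → x < n ^ k → suc x < N ^ suc k
  fits {n} {N} {x} 2≤n n≤N x<n^k = begin-strict
    suc x          ≤⟨ x<n^k ⟩
    n ^ k          <⟨ m<m+n (n ^ k) (≤-<-trans z≤n x<n^k) ⟩
    n ^ k + n ^ k  ≡⟨ cong (n ^ k +_) (+-identityʳ (n ^ k)) ⟨
    2 * n ^ k      ≤⟨ *-mono-≤ (≤-trans 2≤n n≤N) (^-monoˡ-≤ k n≤N) ⟩
    N ^ suc k      ∎
    where open ≤-Reasoning

  rounds : ∀ a b → b * (a + a) ≡ 2 * (a * b)
  rounds a b = begin
    b * (a + a)      ≡⟨ *-comm b (a + a) ⟩
    (a + a) * b      ≡⟨ *-distribʳ-+ b a a ⟩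
    a * b + a * b    ≡⟨ cong (a * b +_) (+-identityʳ (a * b)) ⟨
    2 * (a * b)      ∎
    where open ≡-Reasoning
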